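{- Let $n\ge m\ge 0$ be integers with $n\equiv m \pmod 2$. Then $$\int_{ -\infty}^{\infty} f_n(x) f_m(x)\,dx = \binom{n+m}{\frac{n+m}{2}}.$$
   Context: For $A\subseteq\mathbb{R}$, $\chi_A$ denotes the characteristic function of $A$. Define functions $f_n:\mathbb{R}\to\mathbb{R}$, $n = 0,1,2,\dots$, recursively by $f_0 = \chi_{(-1/2,1/2)}$ and $f_{n+1}(x) = f_n(x+1/2) + f_n(x-1/2)$ for all $x\in\mathbb{R}$. -}

module Defs where

open import Level using (_⊔_) renaming (suc to lsuc)
open import Algebra.Bundles using (CommutativeRing)
import Algebra.Definitions.RawMonoid as RawMonoidDefinitions
import Algebra.Properties.Ring as RingProperties
open import Data.Bool.Base using (if_then_else_)
open import Data.Nat.Base using (ℕ; zero; suc)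
open import Data.Product.Base using (∃; ∃-syntax; Σ-syntax; _×_)
open import Data.Sum.Base using (inj₁; inj₂)
open import Data.Unit.Polymorphic.Base using (⊤)
open import Relation.Binary.Core using (Rel)
open import Relation.Binary.Structures using (IsDecTotalOrder)
import Relation.Binary.Construct.NonStrictToStrict as NonStrictToStrict
open import Relation.Nullary.Decidable.Core using (does; _×-dec_)
open import Relation.Unary using (Pred; Satisfiable; Decidable)

-- The real numbers, characterised up to isomorphism as the complete ordered
-- field. The mathematics is classical: χ_A is a total function on ℝ
-- only because "x ∈ A" is decided for every x, so the order is required to be
-- decidable. Under excluded middle the usual constructions of ℝ (Dedekind cuts
-- or Cauchy sequences of rationals) have all the structure below.
record CompleteOrderedField c ℓ₁ ℓ₂ : Set (lsuc (c ⊔ ℓ₁ ⊔ ℓ₂)) where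
  field
    commutativeRing : CommutativeRing c ℓ₁

  open CommutativeRing commutativeRing public

  infix 8 _⁻¹[_]
  infix 4 _≤_

  field
    1≉0      : 1# ≉ 0#
    _⁻¹[_]   : ∀ x → x ≉ 0# → Carrier
    ⁻¹-inverseʳ : ∀ x (x≉0 : x ≉ 0#) → x * x ⁻¹[ x≉0 ] ≈ 1#

    _≤_             : Rel Carrier ℓ₂
    isDecTotalOrder : IsDecTotalOrder _≈_ _≤_
    +-monoˡ-≤       : ∀ z {x y} → x ≤ y → x + z ≤ y + z
    *-nonNegative   : ∀ {x y} → 0# ≤ x → 0# ≤ y → 0# ≤ x * y

  UpperBound : ∀ {ℓ} → Pred Carrier ℓ → Carrier → Set (c ⊔ ℓ₂ ⊔ ℓ)
  UpperBound A u = ∀ {x} → A x → x ≤ u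

  field
    complete : (A : Pred Carrier (c ⊔ ℓ₁ ⊔ ℓ₂)) →
               Satisfiable A → ∃ (UpperBound A) →
               ∃[ s ] UpperBound A s × (∀ {u} → UpperBound A u → s ≤ u)

  open IsDecTotalOrder isDecTotalOrder public
    using (_≟_; _≤?_; total; antisym; ≤-respˡ-≈; ≤-respʳ-≈)
    renaming (refl to ≤-refl; reflexive to ≤-reflexive; trans to ≤-trans)

  open NonStrictToStrict _≈_ _≤_ public using (_<_; <-decidable)

  open RawMonoidDefinitions +-rawMonoid using () renaming (_×_ to _×′_)

  fromℕ : ℕ → Carrier
  fromℕ n = n ×′ 1#

  ∣_∣ : Carrier → Carrier
  ∣ x ∣ = if does (0# ≤? x) then x else - x

  0≤1 : 0# ≤ 1#
  0≤1 with total 0# 1#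
  ... | inj₁ p = p
  ... | inj₂ 1≤0 = ≤-respʳ-≈ [-1][-1]≈1 (*-nonNegative 0≤-1 0≤-1)
    where
    open RingProperties ring using (-‿involutive; -1*x≈-x)

    0≤-1 : 0# ≤ - 1#
    0≤-1 = ≤-respˡ-≈ (-‿inverseʳ 1#)
             (≤-respʳ-≈ (+-identityˡ (- 1#)) (+-monoˡ-≤ (- 1#) 1≤0))

    [-1][-1]≈1 : - 1# * - 1# ≈ 1#
    [-1][-1]≈1 = trans (-1*x≈-x (- 1#)) (-‿involutive 1#)

  2≉0 : 1# + 1# ≉ 0#
  2≉0 2≈0 = 1≉0 (antisym 1≤0 0≤1)
    where
    1≤0 : 1# ≤ 0#
    1≤0 = ≤-respʳ-≈ 2≈0 (≤-respˡ-≈ (+-identityˡ 1#) (+-monoˡ-≤ 1# 0≤1))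

  ½ : Carrier
  ½ = (1# + 1#) ⁻¹[ 2≉0 ]

module _ {c ℓ₁ ℓ₂} (ℝ : CompleteOrderedField c ℓ₁ ℓ₂) where
  open CompleteOrderedField ℝ

  χ : ∀ {ℓ} {A : Pred Carrier ℓ} → Decidable A → Carrier → Carrier
  χ A? x = if does (A? x) then 1# else 0#

  OpenInterval : Carrier → Carrier → Pred Carrier (ℓ₁ ⊔ ℓ₂)
  OpenInterval a b x = (a < x) × (x < b)

  openInterval? : ∀ a b → Decidable (OpenInterval a b)
  openInterval? a b x = (a <? x) ×-dec (x <? b)
    where _<?_ = <-decidable _≟_ _≤?_

  f : ℕ → Carrier → Carrier
  f zero    x = χ (openInterval? (- ½) ½) x
  f (suc n) x = f n (x + ½) + f n (x - ½)

  -- A partition a = x₀ ≤ x₁ ≤ … ≤ xₖ = b with a tag tᵢ in each [xᵢ₋₁ , xᵢ].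
  data TaggedPartition : Carrier → Carrier → Set (c ⊔ ℓ₁ ⊔ ℓ₂) where
    end  : ∀ {a b} → a ≈ b → TaggedPartition a b
    cons : ∀ {a b} (t x : Carrier) → a ≤ t → t ≤ x →
           TaggedPartition x b → TaggedPartition a b

  MeshBelow : ∀ {a b} → Carrier → TaggedPartition a b → Set (ℓ₁ ⊔ ℓ₂)
  MeshBelow     δ (end _)          = ⊤
  MeshBelow {a} δ (cons t x _ _ p) = (x - a < δ) × MeshBelow δ p

  riemannSum : ∀ {a b} → (Carrier → Carrier) → TaggedPartition a b → Carrier
  riemannSum     g (end _)          = 0#
  riemannSum {a} g (cons t x _ _ p) = g t * (x - a) + riemannSum g p

  -- g is Riemann integrable on [a , b] with integral J.
  HasIntegral : (Carrier → Carrier) → Carrier → Carrier → Carrier →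
                Set (c ⊔ ℓ₁ ⊔ ℓ₂)
  HasIntegral g a b J =
    ∀ ε → 0# < ε → ∃[ δ ] (0# < δ) ×
      ((p : TaggedPartition a b) → MeshBelow δ p → ∣ riemannSum g p - J ∣ < ε)

  -- The integral of g over (-∞ , ∞) exists and equals I: g is integrable on
  -- every [a , b], with integral G a b, and G a b → I as a → -∞ and b → ∞
  -- independently (so this is not merely a principal value).
  HasImproperIntegral : (Carrier → Carrier) → Carrier → Set (c ⊔ ℓ₁ ⊔ ℓ₂)
  HasImproperIntegral g I =
    Σ[ G ∈ (Carrier → Carrier → Carrier) ] (∀ a b → a ≤ b → HasIntegral g a b (G a b)) ×
      (∀ ε → 0# < ε → ∃[ M ] (0# < M) ×
        (∀ a b → a ≤ - M → M ≤ b → ∣ G a b - I ∣ < ε))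

{-# OPTIONS --safe #-}

-- If σ − τ + (n + m)/2 is an integer, then
--   ∫ f_n(x + σ) f_m(x + τ) dx = f_{n+m}(σ − τ).
-- Unfolding one step of f_n on the left moves σ by ±½, unfolding one step of f_m
-- moves τ by ±½, and both match a step of f_{n+m} on the right; so by linearity of
-- the integral everything reduces to n = m = 0. There σ − τ is an integer, and the
-- two unit intervals coincide or are disjoint, according as f_0(σ − τ) is 1 or 0.
-- Finally f_N(k − N/2) = C(N , k) by Pascal's rule, taken at k = N/2, N = n + m.

module Submission where

open import Defs
open import Algebra.Bundles using (RawRing)
import Algebra.Properties.AbelianGroup as AbelianGroupProperties
import Algebra.Properties.CommutativeMonoid.Mult as CommutativeMonoidMult
import Algebra.Properties.CommutativeSemigroup as CommutativeSemigroupProperties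
import Algebra.Properties.Ring as RingProperties
import Algebra.Properties.Semiring.Mult as SemiringMult
import Algebra.Solver.Ring as RingSolver
open import Algebra.Solver.Ring.AlmostCommutativeRing
  using (fromCommutativeRing; _-Raw-AlmostCommutative⟶_)
open import Data.Bool.Base using (if_then_else_)
import Data.Maybe.Base as Maybe
import Data.Nat.Base as ℕ
open ℕ using (zero; suc; z≤n; s≤s)
import Data.Nat.Properties as ℕ
import Data.Nat.DivMod as ℕ
import Data.Nat.Combinatorics as ℕ
open import Data.Product.Base using (∃₂; _×_; _,_; proj₂)
import Data.Product.Properties as Product
open import Data.Sum.Base using (inj₁; inj₂)
open import Level using (_⊔_)
open import Relation.Binary.Bundles using (Poset)
open import Relation.Binary.Definitions using (tri<; tri≈; tri>)
import Relation.Binary.Construct.NonStrictToStrict as NonStrictToStrict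
open import Relation.Binary.PropositionalEquality as ≡ using (_≡_)
import Relation.Binary.Reasoning.PartialOrder as ≤-Reasoning
open import Relation.Binary.Structures using (IsDecTotalOrder)
open import Relation.Nullary.Decidable.Core using (yes; no; does; dec⇒maybe)
open import Relation.Nullary.Decidable using (dec-true; dec-false)
open import Relation.Nullary.Negation.Core using (¬_; contradiction)
open import Relation.Unary using (Pred; Decidable)

nC0≡1 : ∀ n → n ℕ.C 0 ≡ 1
nC0≡1 n = ≡.trans (ℕ.nCk≡nC[n∸k] {0} {n} z≤n) (ℕ.nCn≡1 n)

module _ {c ℓ₁ ℓ₂} (ℝ : CompleteOrderedField c ℓ₁ ℓ₂) where
  private
    open CompleteOrderedField ℝ hiding (zero)
    open RingProperties ring using (x[y-z]≈xy-xz; [y-z]x≈yx-zx; -‿involutive)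
    open AbelianGroupProperties +-abelianGroup
      using (⁻¹-∙-comm; ⁻¹-anti-homo‿-; x∙y⁻¹≈ε⇒x≈y; x≈y⇒x∙y⁻¹≈ε; ε⁻¹≈ε)
    open CommutativeSemigroupProperties +-commutativeSemigroup using (interchange)
    open CommutativeMonoidMult +-commutativeMonoid using (×-congʳ; ×-homo-+; ×-distrib-+)
      renaming (_×_ to _·_)
    open SemiringMult semiring using (×1-homo-*)
    open NonStrictToStrict _≈_ _≤_ using (<⇒≤)

    -- Order reasoning in ℝ.

    poset : Poset c ℓ₁ ℓ₂
    poset = record { isPartialOrder = IsDecTotalOrder.isPartialOrder isDecTotalOrder }

    open ≤-Reasoning poset

    <⇒≱ : ∀ {x y} → x < y → ¬ (y ≤ x)
    <⇒≱ = NonStrictToStrict.<⇒≱ _≈_ _≤_ antisym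

    ≰⇒> : ∀ {x y} → ¬ (x ≤ y) → y < x
    ≰⇒> = NonStrictToStrict.≰⇒> _≈_ _≤_ sym ≤-reflexive total

    ≮⇒≥ : ∀ {x y} → ¬ (x < y) → y ≤ x
    ≮⇒≥ = NonStrictToStrict.≮⇒≥ _≈_ _≤_ sym _≟_ ≤-reflexive total

    ≤-<-trans : ∀ {x y z} → x ≤ y → y < z → x < z
    ≤-<-trans = NonStrictToStrict.≤-<-trans _≈_ _≤_ ≤-trans antisym ≤-respˡ-≈

    <-≤-trans : ∀ {x y z} → x < y → y ≤ z → x < z
    <-≤-trans = NonStrictToStrict.<-≤-trans _≈_ _≤_ sym ≤-trans antisym ≤-respʳ-≈

    -- A ring solver over ℝ with integer coefficients.

    [x-y]+[z-w] : ∀ x y z w → (x - y) + (z - w) ≈ (x + z) - (y + w)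
    [x-y]+[z-w] x y z w = trans (interchange x (- y) z (- w)) (+-congˡ (⁻¹-∙-comm y w))

    [x-y]-[z-w] : ∀ x y z w → (x - y) - (z - w) ≈ (x + w) - (y + z)
    [x-y]-[z-w] x y z w = trans (+-congˡ (⁻¹-anti-homo‿- z w)) ([x-y]+[z-w] x y w z)

    -- A pair (a , b) of naturals, one of which is 0, stands for the integer a − b:
    -- coefficients in this form let the ring solver see which of them cancel.
    reduce : ℕ.ℕ → ℕ.ℕ → ℕ.ℕ × ℕ.ℕ
    reduce (suc a) (suc b) = reduce a b
    reduce a       b       = a , b

    ℕ² : RawRing _ _
    ℕ² = record
      { Carrier = ℕ.ℕ × ℕ.ℕ
      ; _≈_ = _≡_
      ; _+_ = λ (a , b) (c , d) → reduce (a ℕ.+ c) (b ℕ.+ d)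
      ; _*_ = λ (a , b) (c , d) → reduce (a ℕ.* c ℕ.+ b ℕ.* d) (a ℕ.* d ℕ.+ b ℕ.* c)
      ; -_ = λ (a , b) → b , a
      ; 0# = 0 , 0
      ; 1# = 1 , 0
      }

    fromℕ² : ℕ.ℕ × ℕ.ℕ → Carrier
    fromℕ² (a , b) = fromℕ a - fromℕ b

    fromℕ²-reduce : ∀ a b → fromℕ² (reduce a b) ≈ fromℕ a - fromℕ b
    fromℕ²-reduce zero    b       = refl
    fromℕ²-reduce (suc a) zero    = refl
    fromℕ²-reduce (suc a) (suc b) = begin-equality
      fromℕ² (reduce a b)                ≈⟨ fromℕ²-reduce a b ⟩
      fromℕ a - fromℕ b                  ≈⟨ +-identityˡ _ ⟨
      -- Inserting 1 - 1 restores the two successors that `reduce` strips off.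
      0# + (fromℕ a - fromℕ b)           ≈⟨ +-congʳ (-‿inverseʳ 1#) ⟨
      (1# - 1#) + (fromℕ a - fromℕ b)    ≈⟨ [x-y]+[z-w] _ _ _ _ ⟩
      fromℕ (suc a) - fromℕ (suc b)      ∎

    difference : ℕ² -Raw-AlmostCommutative⟶ fromCommutativeRing commutativeRing
    difference = record
      { ⟦_⟧ = fromℕ²
      ; +-homo = λ (a , b) (c , d) → begin-equality
          fromℕ² (reduce (a ℕ.+ c) (b ℕ.+ d))        ≈⟨ fromℕ²-reduce (a ℕ.+ c) (b ℕ.+ d) ⟩
          fromℕ (a ℕ.+ c) - fromℕ (b ℕ.+ d)
            ≈⟨ +-cong (×-homo-+ 1# a c) (-‿cong (×-homo-+ 1# b d)) ⟩
          (fromℕ a + fromℕ c) - (fromℕ b + fromℕ d)  ≈⟨ [x-y]+[z-w] _ _ _ _ ⟨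
          (fromℕ a - fromℕ b) + (fromℕ c - fromℕ d)  ∎
      ; *-homo = λ (a , b) (c , d) → begin-equality
          fromℕ² (reduce (a ℕ.* c ℕ.+ b ℕ.* d) (a ℕ.* d ℕ.+ b ℕ.* c))
            ≈⟨ fromℕ²-reduce (a ℕ.* c ℕ.+ b ℕ.* d) (a ℕ.* d ℕ.+ b ℕ.* c) ⟩
          fromℕ (a ℕ.* c ℕ.+ b ℕ.* d) - fromℕ (a ℕ.* d ℕ.+ b ℕ.* c)
            ≈⟨ +-cong (homo a c b d) (-‿cong (homo a d b c)) ⟩
          (fromℕ a * fromℕ c + fromℕ b * fromℕ d) - (fromℕ a * fromℕ d + fromℕ b * fromℕ c)
            ≈⟨ [x-y]-[z-w] _ _ _ _ ⟨
          (fromℕ a * fromℕ c - fromℕ a * fromℕ d) - (fromℕ b * fromℕ c - fromℕ b * fromℕ d)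
            ≈⟨ +-cong (x[y-z]≈xy-xz _ _ _) (-‿cong (x[y-z]≈xy-xz _ _ _)) ⟨
          fromℕ a * (fromℕ c - fromℕ d) - fromℕ b * (fromℕ c - fromℕ d)
            ≈⟨ [y-z]x≈yx-zx _ _ _ ⟨
          (fromℕ a - fromℕ b) * (fromℕ c - fromℕ d) ∎
      ; -‿homo = λ (a , b) → sym (⁻¹-anti-homo‿- _ _)
      ; 0-homo = -‿inverseʳ 0#
      ; 1-homo = trans (+-cong (+-identityʳ 1#) ε⁻¹≈ε) (+-identityʳ 1#)
      }
      where
      homo : ∀ a c b d → fromℕ (a ℕ.* c ℕ.+ b ℕ.* d) ≈ fromℕ a * fromℕ c + fromℕ b * fromℕ d
      homo a c b d = trans (×-homo-+ 1# (a ℕ.* c) (b ℕ.* d)) (+-cong (×1-homo-* a c) (×1-homo-* b d))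

    open RingSolver ℕ² (fromCommutativeRing commutativeRing) difference
      -- Coefficients are compared as pairs; in reduced form equal integers are equal pairs, so this
      -- test finds every cancellation.
      (λ p q → Maybe.map (λ p≡q → reflexive (≡.cong fromℕ² p≡q))
        (dec⇒maybe (Product.≡-dec ℕ._≟_ ℕ._≟_ p q)))
      using (solve; _:=_; _:+_; _:*_; _:-_; :-_)

    -- Inequalities in an ordered field.

    -- Adding x - a to both sides of `a ≤ b` gives the conclusion. Linear inequalities below take
    -- this form: a known inequality, and a ring identity between differences that the solver
    -- proves.
    ≤-by : ∀ {x y a b} → a ≤ b → b - a ≈ y - x → x ≤ y
    ≤-by {x} {y} {a} {b} a≤b b-a≈y-x = begin
      x           ≈⟨ solve 2 (λ x a → x := a :+ (x :- a)) refl x a ⟩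
      a + (x - a) ≤⟨ +-monoˡ-≤ (x - a) a≤b ⟩
      b + (x - a) ≈⟨ solve 3 (λ x a b → b :+ (x :- a) := (b :- a) :+ x) refl x a b ⟩
      (b - a) + x ≈⟨ +-congʳ b-a≈y-x ⟩
      (y - x) + x ≈⟨ solve 2 (λ x y → (y :- x) :+ x := y) refl x y ⟩
      y           ∎

    <-by : ∀ {x y a b} → a < b → b - a ≈ y - x → x < y
    <-by a<b b-a≈y-x = ≰⇒> λ y≤x → <⇒≱ a<b (≤-by y≤x (begin-equality
      _ ≈⟨ ⁻¹-anti-homo‿- _ _ ⟨
      _ ≈⟨ -‿cong b-a≈y-x ⟨
      _ ≈⟨ ⁻¹-anti-homo‿- _ _ ⟩
      _ ∎))

    +-mono-≤ : ∀ {x y z w} → x ≤ y → z ≤ w → x + z ≤ y + w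
    +-mono-≤ {x} {y} {z} {w} x≤y z≤w = begin
      x + z ≤⟨ +-monoˡ-≤ z x≤y ⟩
      y + z ≤⟨ ≤-by z≤w (solve 3 (λ y z w → w :- z := (y :+ w) :- (y :+ z)) refl y z w) ⟩
      y + w ∎

    +-mono-<-≤ : ∀ {x y z w} → x < y → z ≤ w → x + z < y + w
    +-mono-<-≤ {x} {y} {z} {w} x<y z≤w = ≰⇒> λ y+w≤x+z →
      <⇒≱ x<y (≤-by (+-mono-≤ y+w≤x+z z≤w)
        (solve 4 (λ x y z w → ((x :+ z) :+ w) :- ((y :+ w) :+ z) := x :- y) refl x y z w))

    0≤y-x : ∀ {x y} → x ≤ y → 0# ≤ y - x
    0≤y-x {x} {y} x≤y = begin
      0#    ≈⟨ -‿inverseʳ x ⟨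
      x - x ≤⟨ +-monoˡ-≤ (- x) x≤y ⟩
      y - x ∎

    neg-mono-≤ : ∀ {x y} → x ≤ y → - y ≤ - x
    neg-mono-≤ {x} {y} x≤y = ≤-by x≤y (solve 2 (λ x y → y :- x := :- x :- (:- y)) refl x y)

    *-monoʳ-≤ : ∀ {x y z} → 0# ≤ z → x ≤ y → z * x ≤ z * y
    *-monoʳ-≤ {x} {y} {z} 0≤z x≤y = ≤-by (*-nonNegative 0≤z (0≤y-x x≤y))
      (trans (trans (+-congˡ ε⁻¹≈ε) (+-identityʳ _)) (x[y-z]≈xy-xz z y x))

    fromℕ-mono-≤ : ∀ {m n} → m ℕ.≤ n → fromℕ m ≤ fromℕ n
    fromℕ-mono-≤ {n = zero}  z≤n = ≤-refl
    fromℕ-mono-≤ {n = suc n} z≤n = begin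
      0#           ≤⟨ fromℕ-mono-≤ {n = n} z≤n ⟩
      fromℕ n      ≈⟨ +-identityˡ _ ⟨
      0# + fromℕ n ≤⟨ +-monoˡ-≤ _ 0≤1 ⟩
      1# + fromℕ n ∎
    fromℕ-mono-≤ (s≤s m≤n) = +-mono-≤ ≤-refl (fromℕ-mono-≤ m≤n)

    0<1 : 0# < 1#
    0<1 = 0≤1 , λ 0≈1 → 1≉0 (sym 0≈1)

    ½+½≈1 : ½ + ½ ≈ 1#
    ½+½≈1 = begin-equality
      ½ + ½           ≈⟨ +-cong (*-identityˡ ½) (*-identityˡ ½) ⟨
      1# * ½ + 1# * ½ ≈⟨ distribʳ ½ 1# 1# ⟨
      (1# + 1#) * ½   ≈⟨ ⁻¹-inverseʳ (1# + 1#) 2≉0 ⟩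
      1#              ∎

    0<½ : 0# < ½
    0<½ = ≰⇒> λ ½≤0 → <⇒≱ 0<1 (begin
      1#      ≈⟨ ½+½≈1 ⟨
      ½ + ½   ≤⟨ +-mono-≤ ½≤0 ½≤0 ⟩
      0# + 0# ≈⟨ +-identityʳ 0# ⟩
      0#      ∎)

    -½<0 : - ½ < 0#
    -½<0 = <-by 0<½ (begin-equality
      ½ - 0#     ≈⟨ +-congˡ ε⁻¹≈ε ⟩
      ½ + 0#     ≈⟨ +-comm ½ 0# ⟩
      0# + ½     ≈⟨ +-congˡ (-‿involutive ½) ⟨
      0# - - ½   ∎)

    -½<½ : - ½ < ½
    -½<½ = <-≤-trans -½<0 (<⇒≤ 0<½)

    -- Absolute values and two-sided bounds.

    x≤∣x∣ : ∀ x → x ≤ ∣ x ∣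
    x≤∣x∣ x with 0# ≤? x
    ... | yes _ = ≤-refl
    ... | no 0≰x = ≤-trans x≤0 (begin
          0#   ≈⟨ ε⁻¹≈ε ⟨
          - 0# ≤⟨ neg-mono-≤ x≤0 ⟩
          - x  ∎)
      where x≤0 = <⇒≤ (≰⇒> 0≰x)

    -x≤∣x∣ : ∀ x → - x ≤ ∣ x ∣
    -x≤∣x∣ x with 0# ≤? x
    ... | no _ = ≤-refl
    ... | yes 0≤x = begin
      - x  ≤⟨ neg-mono-≤ 0≤x ⟩
      - 0# ≈⟨ ε⁻¹≈ε ⟩
      0#   ≤⟨ 0≤x ⟩
      x    ∎

    0≤∣x∣ : ∀ x → 0# ≤ ∣ x ∣
    0≤∣x∣ x with total 0# x
    ... | inj₁ 0≤x = ≤-trans 0≤x (x≤∣x∣ x)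
    ... | inj₂ x≤0 = begin
      0#    ≈⟨ ε⁻¹≈ε ⟨
      - 0#  ≤⟨ neg-mono-≤ x≤0 ⟩
      - x   ≤⟨ -x≤∣x∣ x ⟩
      ∣ x ∣ ∎

    infix 4 _≤±_

    -- This is ∣ x ∣ ≤ w as a pair of inequalities, so that bounds can be added and negated without
    -- cases on the sign of x.
    _≤±_ : Carrier → Carrier → Set _
    x ≤± w = x ≤ w × - x ≤ w

    ≤±⇒∣∣≤ : ∀ {x w} → x ≤± w → ∣ x ∣ ≤ w
    ≤±⇒∣∣≤ {x} (x≤w , -x≤w) with 0# ≤? x
    ... | yes _ = x≤w
    ... | no _ = -x≤w

    ≤±-resp-≈ : ∀ {x y w v} → x ≈ y → w ≈ v → x ≤± w → y ≤± v
    ≤±-resp-≈ x≈y w≈v (x≤w , -x≤w) =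
      ≤-respˡ-≈ x≈y (≤-respʳ-≈ w≈v x≤w) , ≤-respˡ-≈ (-‿cong x≈y) (≤-respʳ-≈ w≈v -x≤w)

    +-mono-≤± : ∀ {x y w v} → x ≤± w → y ≤± v → x + y ≤± w + v
    +-mono-≤± (x≤w , -x≤w) (y≤v , -y≤v) =
      +-mono-≤ x≤w y≤v , ≤-respˡ-≈ (⁻¹-∙-comm _ _) (+-mono-≤ -x≤w -y≤v)

    neg-≤± : ∀ {x w} → x ≤± w → - x ≤± w
    neg-≤± {x} (x≤w , -x≤w) = -x≤w , ≤-respˡ-≈ (solve 1 (λ x → x := :- (:- x)) refl x) x≤w

    ≤±-trans : ∀ {x w v} → x ≤± w → w ≤ v → x ≤± v
    ≤±-trans (x≤w , -x≤w) w≤v = ≤-trans x≤w w≤v , ≤-trans -x≤w w≤v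

    0≤±0 : 0# ≤± 0#
    0≤±0 = ≤-refl , ≤-reflexive ε⁻¹≈ε

    -- Primitives with an error estimate, and Riemann integrability.

    -- F is a primitive of g, and V is a monotone function whose increments bound
    -- the oscillation of g: the estimates add up, so that the Riemann sums of g
    -- over a partition of mesh at most δ are within (V b − V a) δ of F b − F a.
    record Primitive (g F : Carrier → Carrier) : Set (c ⊔ ℓ₁ ⊔ ℓ₂) where
      field
        V        : Carrier → Carrier
        V-mono   : ∀ {x y} → x ≤ y → V x ≤ V y
        estimate : ∀ {a t x} → a ≤ t → t ≤ x →
                   g t * (x - a) - (F x - F a) ≤± (V x - V a) * (x - a)

    open Primitive

    primitive-0 : Primitive (λ _ → 0#) (λ _ → 0#)
    primitive-0 .V _ = 0#
    primitive-0 .V-mono _ = ≤-refl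
    primitive-0 .estimate {a} {t} {x} _ _ = ≤±-resp-≈
      (sym 0*w-[0-0]≈0) (sym (trans (*-congʳ (-‿inverseʳ 0#)) (zeroˡ _))) 0≤±0
      where
      0*w-[0-0]≈0 : ∀ {w} → 0# * w - (0# - 0#) ≈ 0#
      0*w-[0-0]≈0 = trans (+-cong (zeroˡ _) (-‿cong (-‿inverseʳ 0#))) (-‿inverseʳ 0#)

    primitive-+ : ∀ {g h F H} → Primitive g F → Primitive h H →
                  Primitive (λ x → g x + h x) (λ x → F x + H x)
    primitive-+ P Q .V x = P .V x + Q .V x
    primitive-+ P Q .V-mono x≤y = +-mono-≤ (P .V-mono x≤y) (Q .V-mono x≤y)
    primitive-+ {g} {h} {F} {H} P Q .estimate {a} {t} {x} a≤t t≤x = ≤±-resp-≈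
      (solve 7 (λ g h w F F′ H H′ →
          ((g :* w) :- (F :- F′)) :+ ((h :* w) :- (H :- H′)) :=
          ((g :+ h) :* w) :- ((F :+ H) :- (F′ :+ H′)))
        refl (g t) (h t) (x - a) (F x) (F a) (H x) (H a))
      (solve 5 (λ V V′ W W′ w →
          ((V :- V′) :* w) :+ ((W :- W′) :* w) := ((V :+ W) :- (V′ :+ W′)) :* w)
        refl (P .V x) (P .V a) (Q .V x) (Q .V a) (x - a))
      (+-mono-≤± (P .estimate a≤t t≤x) (Q .estimate a≤t t≤x))

    primitive-neg : ∀ {g F} → Primitive g F → Primitive (λ x → - g x) (λ x → - F x)
    primitive-neg P .V = P .V
    primitive-neg P .V-mono = P .V-mono
    primitive-neg {g} {F} P .estimate {a} {t} {x} a≤t t≤x = ≤±-resp-≈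
      (solve 4 (λ g w F F′ →
          :- ((g :* w) :- (F :- F′)) := ((:- g) :* w) :- ((:- F) :- (:- F′)))
        refl (g t) (x - a) (F x) (F a))
      refl
      (neg-≤± (P .estimate a≤t t≤x))

    primitive-cong : ∀ {g h F} → (∀ x → g x ≈ h x) → Primitive g F → Primitive h F
    primitive-cong g≈h P .V = P .V
    primitive-cong g≈h P .V-mono = P .V-mono
    primitive-cong g≈h P .estimate {a} {t} {x} a≤t t≤x =
      ≤±-resp-≈ (+-congʳ (*-congʳ (g≈h t))) refl (P .estimate a≤t t≤x)

    module _ {g F : Carrier → Carrier} (P : Primitive g F) where

      estimate-mesh : ∀ {a t x δ} → a ≤ t → t ≤ x → x - a ≤ δ →
                      g t * (x - a) - (F x - F a) ≤± (P .V x - P .V a) * δ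
      estimate-mesh a≤t t≤x x-a≤δ = ≤±-trans (P .estimate a≤t t≤x)
        (*-monoʳ-≤ (0≤y-x (P .V-mono (≤-trans a≤t t≤x))) x-a≤δ)

      -- With the width of every cell replaced by the common bound δ, the increments of `F` and
      -- those of `V` both telescope along the partition.
      riemannSum-estimate : ∀ {a b δ} → 0# < δ → (p : TaggedPartition ℝ a b) → MeshBelow ℝ δ p →
                            riemannSum ℝ g p - (F b - F a) ≤± (P .V b - P .V a) * δ
      -- `F` and `V` are not assumed to respect `≈`, so `F b - F a` cannot be cancelled directly; it
      -- is bounded by the estimate on the degenerate cell from a to b with tag a.
      riemannSum-estimate {a} {b} {δ} 0<δ (end a≈b) _ = ≤±-resp-≈
        (+-congʳ (trans (*-congˡ b-a≈0) (zeroʳ (g a)))) refl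
        (estimate-mesh ≤-refl (≤-reflexive a≈b) (≤-respˡ-≈ (sym b-a≈0) (<⇒≤ 0<δ)))
        where b-a≈0 = x≈y⇒x∙y⁻¹≈ε (sym a≈b)
      riemannSum-estimate {a} {b} {δ} 0<δ (cons t x a≤t t≤x p) (x-a<δ , mesh) = ≤±-resp-≈
        (solve 5 (λ u F F′ F″ r →
            (u :- (F′ :- F)) :+ (r :- (F″ :- F′)) := (u :+ r) :- (F″ :- F))
          refl (g t * (x - a)) (F a) (F x) (F b) (riemannSum ℝ g p))
        (solve 4 (λ V V′ V″ δ → ((V′ :- V) :* δ) :+ ((V″ :- V′) :* δ) := (V″ :- V) :* δ)
          refl (P .V a) (P .V x) (P .V b) δ)
        (+-mono-≤± (estimate-mesh a≤t t≤x (<⇒≤ x-a<δ)) (riemannSum-estimate 0<δ p mesh))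

      hasIntegral : ∀ a b → a ≤ b → HasIntegral ℝ g a b (F b - F a)
      hasIntegral a b a≤b ε 0<ε = δ , 0<δ , λ p mesh →
        ≤-<-trans (≤±⇒∣∣≤ (riemannSum-estimate 0<δ p mesh)) Wδ<ε
        where
        W K δ : Carrier
        W = P .V b - P .V a
        -- With δ = ε / (W + 1), the added 1 makes the divisor positive even when W = 0 and makes Wδ
        -- < ε strict.
        K = W + 1#

        0≤W : 0# ≤ W
        0≤W = 0≤y-x (P .V-mono a≤b)

        0<K : 0# < K
        0<K = begin-strict
          0#      <⟨ 0<1 ⟩
          1#      ≈⟨ +-identityˡ 1# ⟨
          0# + 1# ≤⟨ +-monoˡ-≤ 1# 0≤W ⟩
          K       ∎

        K≉0 : K ≉ 0#
        K≉0 K≈0 = proj₂ 0<K (sym K≈0)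

        δ = K ⁻¹[ K≉0 ] * ε

        Kδ≈ε : K * δ ≈ ε
        Kδ≈ε = begin-equality
          K * δ                  ≈⟨ *-assoc K _ ε ⟨
          K * K ⁻¹[ K≉0 ] * ε    ≈⟨ *-congʳ (⁻¹-inverseʳ K K≉0) ⟩
          1# * ε                 ≈⟨ *-identityˡ ε ⟩
          ε                      ∎

        0<δ : 0# < δ
        0<δ = ≰⇒> λ δ≤0 → <⇒≱ 0<ε (begin
          ε      ≈⟨ Kδ≈ε ⟨
          K * δ  ≤⟨ *-monoʳ-≤ (<⇒≤ 0<K) δ≤0 ⟩
          K * 0# ≈⟨ zeroʳ K ⟩
          0#     ∎)

        Wδ<ε : W * δ < ε
        Wδ<ε = begin-strict
          W * δ          ≈⟨ +-identityˡ _ ⟨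
          0# + W * δ     <⟨ +-mono-<-≤ 0<δ ≤-refl ⟩
          δ + W * δ      ≈⟨ +-comm _ _ ⟩
          W * δ + δ      ≈⟨ +-congˡ (*-identityˡ δ) ⟨
          W * δ + 1# * δ ≈⟨ distribʳ δ W 1# ⟨
          K * δ          ≈⟨ Kδ≈ε ⟩
          ε              ∎

    -- Integrals over the whole line.

    -- Asking the primitive to be constant on both sides of [-M , M] makes the integral over any
    -- larger interval equal to I exactly. Such data are closed under sums, which is what the
    -- induction on n and m needs.
    record TotalIntegral (g : Carrier → Carrier) (I : Carrier) : Set (c ⊔ ℓ₁ ⊔ ℓ₂) where
      field
        F           : Carrier → Carrier
        isPrimitive : Primitive g F
        M           : Carrier
        0<M         : 0# < M
        F≈0         : ∀ {x} → x ≤ - M → F x ≈ 0#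
        F≈I         : ∀ {x} → M ≤ x → F x ≈ I

    open TotalIntegral

    totalIntegral-0 : TotalIntegral (λ _ → 0#) 0#
    totalIntegral-0 = record
      { F = λ _ → 0# ; isPrimitive = primitive-0 ; M = 1# ; 0<M = 0<1
      ; F≈0 = λ _ → refl ; F≈I = λ _ → refl }

    totalIntegral-+ : ∀ {g h I J} → TotalIntegral g I → TotalIntegral h J →
                      TotalIntegral (λ x → g x + h x) (I + J)
    totalIntegral-+ S T = record
      { F = λ x → S .F x + T .F x
      ; isPrimitive = primitive-+ (S .isPrimitive) (T .isPrimitive)
      -- As both radii are positive, their sum bounds each of them and can stand in for the maximum.
      ; M = S .M + T .M
      ; 0<M = <-≤-trans (S .0<M) M≤
      ; F≈0 = λ x≤-M → trans
          (+-cong (S .F≈0 (≤-trans x≤-M (neg-mono-≤ M≤))) (T .F≈0 (≤-trans x≤-M (neg-mono-≤ M≤′))))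
          (+-identityʳ 0#)
      ; F≈I = λ M≤x → +-cong (S .F≈I (≤-trans M≤ M≤x)) (T .F≈I (≤-trans M≤′ M≤x))
      }
      where
      M≤ : S .M ≤ S .M + T .M
      M≤ = ≤-respˡ-≈ (+-identityʳ _) (+-mono-≤ ≤-refl (<⇒≤ (T .0<M)))

      M≤′ : T .M ≤ S .M + T .M
      M≤′ = ≤-respˡ-≈ (+-identityˡ _) (+-monoˡ-≤ _ (<⇒≤ (S .0<M)))

    totalIntegral-cong : ∀ {g h I J} → (∀ x → g x ≈ h x) → I ≈ J →
                         TotalIntegral g I → TotalIntegral h J
    totalIntegral-cong g≈h I≈J S = record
      { TotalIntegral S
      ; isPrimitive = primitive-cong g≈h (S .isPrimitive)
      ; F≈I = λ M≤x → trans (S .F≈I M≤x) I≈J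
      }

    hasImproperIntegral : ∀ {g I} → TotalIntegral g I → HasImproperIntegral ℝ g I
    hasImproperIntegral {g} {I} S =
      (λ a b → S .F b - S .F a) , hasIntegral (S .isPrimitive) , λ ε 0<ε →
        -- The same M serves for every ε, since the error beyond it is 0.
        S .M , S .0<M , λ a b a≤-M M≤b → begin-strict
          ∣ S .F b - S .F a - I ∣ ≤⟨ ≤±⇒∣∣≤ (≤±-resp-≈ (sym (F-I≈0 a≤-M M≤b)) refl 0≤±0) ⟩
          0#                      <⟨ 0<ε ⟩
          ε                       ∎
      where
      F-I≈0 : ∀ {a b} → a ≤ - S .M → S .M ≤ b → S .F b - S .F a - I ≈ 0#
      F-I≈0 {a} {b} a≤-M M≤b = begin-equality
        S .F b - S .F a - I ≈⟨ +-congʳ (+-cong (S .F≈I M≤b) (-‿cong (S .F≈0 a≤-M))) ⟩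
        I - 0# - I          ≈⟨ solve 2 (λ I z → I :- z :- I := :- z) refl I 0# ⟩
        - 0#                ≈⟨ ε⁻¹≈ε ⟩
        0#                  ∎

    -- Characteristic functions and the primitive of a step function.

    module _ {ℓ} {A : Pred Carrier ℓ} (A? : Decidable A) where

      χ-∈ : ∀ {x} → A x → χ ℝ A? x ≡ 1#
      χ-∈ {x} x∈A rewrite dec-true (A? x) x∈A = ≡.refl

      χ-∉ : ∀ {x} → ¬ A x → χ ℝ A? x ≡ 0#
      χ-∉ {x} x∉A rewrite dec-false (A? x) x∉A = ≡.refl

    -- An up-set with threshold d: (d , ∞) or [d , ∞).
    module Heaviside {ℓ} {A : Pred Carrier ℓ} (A? : Decidable A) (d : Carrier)
                     (A-up : ∀ {x y} → x ≤ y → A x → A y)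
                     (A⇒d≤ : ∀ {x} → A x → d ≤ x) (¬A⇒≤d : ∀ {x} → ¬ A x → x ≤ d) where

      -- This is max (x - d , 0). Branching on `A?` instead of on the sign keeps its cases aligned
      -- with those of the step function.
      ramp : Carrier → Carrier
      ramp x = if does (A? x) then x - d else 0#

      ramp-∈ : ∀ {x} → A x → ramp x ≡ x - d
      ramp-∈ {x} x∈A rewrite dec-true (A? x) x∈A = ≡.refl

      ramp-∉ : ∀ {x} → ¬ A x → ramp x ≡ 0#
      ramp-∉ {x} x∉A rewrite dec-false (A? x) x∉A = ≡.refl

      [1-0]*w : ∀ {w} → w ≈ (1# - 0#) * w
      [1-0]*w {w} = sym (begin-equality
        (1# - 0#) * w ≈⟨ *-congʳ (trans (+-congˡ ε⁻¹≈ε) (+-identityʳ 1#)) ⟩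
        1# * w        ≈⟨ *-identityˡ w ⟩
        w             ∎)

      -- A monotone function bounds its own oscillation, so the step function is its own `V`. Where
      -- it is constant on [a , x] the error is 0; where it jumps, the error may be as large as x -
      -- a.
      primitive-χ : Primitive (χ ℝ A?) ramp
      primitive-χ .V = χ ℝ A?
      primitive-χ .V-mono {x} {y} x≤y with A? x | A? y
      ... | yes _   | yes _   = ≤-refl
      ... | yes x∈A | no y∉A  = contradiction (A-up x≤y x∈A) y∉A
      ... | no _    | yes _   = 0≤1
      ... | no _    | no _    = ≤-refl
      primitive-χ .estimate {a} {t} {x} a≤t t≤x with A? a | A? t | A? x
      ... | yes a∈A | no t∉A  | _      = contradiction (A-up a≤t a∈A) t∉A
      ... | _       | yes t∈A | no x∉A = contradiction (A-up t≤x t∈A) x∉A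
      ... | yes _   | yes _   | yes _   = ≤±-resp-≈
        (sym (begin-equality
          1# * (x - a) - (x - d - (a - d)) ≈⟨ +-congʳ (*-identityˡ _) ⟩
          x - a - (x - d - (a - d))
            ≈⟨ solve 4 (λ x a d z → x :- a :- (x :- d :- (a :- d)) := z :- z) refl x a d 0# ⟩
          0# - 0#                          ≈⟨ -‿inverseʳ 0# ⟩
          0#                               ∎))
        (sym (trans (*-congʳ (-‿inverseʳ 1#)) (zeroˡ _))) 0≤±0
      ... | no _    | no _    | no _    = ≤±-resp-≈
        (sym (trans (+-cong (zeroˡ _) (-‿cong (-‿inverseʳ 0#))) (-‿inverseʳ 0#)))
        (sym (trans (*-congʳ (-‿inverseʳ 0#)) (zeroˡ _))) 0≤±0
      -- The jump comes after the tag: the error is d - x, with d between a and x.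
      ... | no a∉A  | no _    | yes x∈A = ≤±-resp-≈
        (begin-equality
          d - x                         ≈⟨ +-identityˡ _ ⟨
          0# + (d - x)                  ≈⟨ +-cong (zeroˡ _) (+-identityʳ _) ⟨
          0# * (x - a) + (d - x + 0#)
            ≈⟨ solve 4 (λ x a d z → z :* (x :- a) :+ (d :- x :+ z) := z :* (x :- a) :- (x :- d :- z))
                 refl x a d 0# ⟩
          0# * (x - a) - (x - d - 0#)   ∎)
        [1-0]*w
        ( ≤-by (+-mono-≤ (A⇒d≤ x∈A) (≤-trans a≤t t≤x))
            (solve 3 (λ x a d → x :+ x :- (d :+ a) := x :- a :- (d :- x)) refl x a d)
        , ≤-by (¬A⇒≤d a∉A)
            (solve 3 (λ x a d → d :- a := x :- a :- (:- (d :- x))) refl x a d))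
      -- The jump comes no later than the tag: the error is d - a.
      ... | no a∉A  | yes _   | yes x∈A = ≤±-resp-≈
        (begin-equality
          d - a                         ≈⟨ +-identityʳ _ ⟨
          d - a + 0#
            ≈⟨ solve 4 (λ x a d z → d :- a :+ z := x :- a :- (x :- d :- z)) refl x a d 0# ⟩
          x - a - (x - d - 0#)          ≈⟨ +-congʳ (*-identityˡ _) ⟨
          1# * (x - a) - (x - d - 0#)   ∎)
        [1-0]*w
        ( ≤-by (A⇒d≤ x∈A)
            (solve 3 (λ x a d → x :- d := x :- a :- (d :- a)) refl x a d)
        , ≤-by (+-mono-≤ (≤-trans a≤t t≤x) (¬A⇒≤d a∉A))
            (solve 3 (λ x a d → x :+ d :- (a :+ a) := x :- a :- (:- (d :- a))) refl x a d))

    -- Values and products of f₀.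

    f₀-inside : ∀ {y} → - ½ < y → y < ½ → f ℝ 0 y ≈ 1#
    f₀-inside -½<y y<½ = reflexive (χ-∈ (openInterval? ℝ (- ½) ½) (-½<y , y<½))

    f₀-left : ∀ {y} → y ≤ - ½ → f ℝ 0 y ≈ 0#
    f₀-left y≤-½ = reflexive (χ-∉ (openInterval? ℝ (- ½) ½) λ (-½<y , _) → <⇒≱ -½<y y≤-½)

    f₀-right : ∀ {y} → ½ ≤ y → f ℝ 0 y ≈ 0#
    f₀-right ½≤y = reflexive (χ-∉ (openInterval? ℝ (- ½) ½) λ (_ , y<½) → <⇒≱ y<½ ½≤y)

    data Position (y : Carrier) : Set (ℓ₁ ⊔ ℓ₂) where
      left   : y ≤ - ½ → Position y
      inside : - ½ < y → y < ½ → Position y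
      right  : ½ ≤ y → Position y

    position : ∀ y → Position y
    position y with y ≤? - ½ | ½ ≤? y
    ... | yes y≤-½ | _       = left y≤-½
    ... | no _     | yes ½≤y = right ½≤y
    ... | no y≰-½  | no ½≰y  = inside (≰⇒> y≰-½) (≰⇒> ½≰y)

    -- The order respects `≈`, so equal arguments fall in the same region of the line, and f₀ is
    -- constant on each region.
    f-cong : ∀ n {x y} → x ≈ y → f ℝ n x ≈ f ℝ n y
    f-cong zero {x} {y} x≈y with position x
    ... | left x≤-½  = trans (f₀-left x≤-½) (sym (f₀-left (≤-respˡ-≈ x≈y x≤-½)))
    ... | right ½≤x  = trans (f₀-right ½≤x) (sym (f₀-right (≤-respʳ-≈ x≈y ½≤x)))
    ... | inside -½<x x<½ = trans (f₀-inside -½<x x<½) (sym (f₀-inside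
      (≰⇒> λ y≤-½ → <⇒≱ -½<x (≤-respˡ-≈ (sym x≈y) y≤-½))
      (≰⇒> λ ½≤y → <⇒≱ x<½ (≤-respʳ-≈ (sym x≈y) ½≤y))))
    f-cong (suc n) x≈y = +-cong (f-cong n (+-congʳ x≈y)) (f-cong n (+-congʳ x≈y))

    f₀-idem : ∀ y → f ℝ 0 y * f ℝ 0 y ≈ f ℝ 0 y
    f₀-idem y with position y
    ... | left y≤-½ = trans (*-congʳ (f₀-left y≤-½)) (trans (zeroˡ _) (sym (f₀-left y≤-½)))
    ... | inside -½<y y<½ = trans (*-congʳ (f₀-inside -½<y y<½)) (*-identityˡ _)
    ... | right ½≤y = trans (*-congʳ (f₀-right ½≤y)) (trans (zeroˡ _) (sym (f₀-right ½≤y)))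

    -- The open interval has length 1, so x < ½ already pushes y to -½ or below.
    f₀-disjoint : ∀ {x y} → 1# ≤ x - y → f ℝ 0 x * f ℝ 0 y ≈ 0#
    f₀-disjoint {x} {y} 1≤x-y with position x
    ... | left x≤-½ = trans (*-congʳ (f₀-left x≤-½)) (zeroˡ _)
    ... | right ½≤x = trans (*-congʳ (f₀-right ½≤x)) (zeroˡ _)
    ... | inside _ x<½ = trans (*-congˡ (f₀-left y≤-½)) (zeroʳ _)
      where
      y≤-½ : y ≤ - ½
      y≤-½ = ≤-by (+-mono-≤ (≤-respˡ-≈ (sym ½+½≈1) 1≤x-y) (<⇒≤ x<½))
        (solve 3 (λ x y h → x :- y :+ h :- (h :+ h :+ x) := :- h :- y) refl x y ½)

    ½≤1 : ½ ≤ 1#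
    ½≤1 = ≤-respʳ-≈ ½+½≈1 (≤-respˡ-≈ (+-identityˡ ½) (+-monoˡ-≤ ½ (<⇒≤ 0<½)))

    f₀-0 : f ℝ 0 0# ≈ 1#
    f₀-0 = f₀-inside -½<0 0<½

    -- The integral of a translate of f₀.

    -- The indicator of an open interval is the step at its left end, strict there, minus the step
    -- at its right end, non-strict there. Far to the right the two ramps differ by the length ½ +
    -- ½.
    totalIntegral-f₀ : ∀ σ → TotalIntegral (λ x → f ℝ 0 (x + σ)) 1#
    totalIntegral-f₀ σ = record
      { F = λ x → L.ramp x - R.ramp x
      ; isPrimitive = primitive-cong χ-χ≈f₀ (primitive-+ L.primitive-χ (primitive-neg R.primitive-χ))
      -- Both thresholds, -½ - σ and ½ - σ, lie within ∣ σ ∣ + ½ of 0.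
      ; M = ∣ σ ∣ + 1#
      ; 0<M = <-≤-trans 0<1 (≤-respˡ-≈ (+-identityˡ 1#) (+-monoˡ-≤ 1# (0≤∣x∣ σ)))
      ; F≈0 = λ x≤-M → let x+σ≤-½ = ≤-½ x≤-M in trans
          (+-cong (reflexive (L.ramp-∉ λ -½<x+σ → <⇒≱ -½<x+σ x+σ≤-½))
            (-‿cong (reflexive (R.ramp-∉ λ ½≤x+σ → <⇒≱ -½<½ (≤-trans ½≤x+σ x+σ≤-½)))))
          (-‿inverseʳ 0#)
      ; F≈I = λ {x} M≤x → let ½≤x+σ = ½≤ M≤x in begin-equality
          L.ramp x - R.ramp x
            ≈⟨ +-cong (reflexive (L.ramp-∈ (<-≤-trans -½<½ ½≤x+σ)))
                 (-‿cong (reflexive (R.ramp-∈ ½≤x+σ))) ⟩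
          (x - (- ½ - σ)) - (x - (½ - σ))
            ≈⟨ solve 3 (λ x h s → x :- (:- h :- s) :- (x :- (h :- s)) := h :+ h) refl x ½ σ ⟩
          ½ + ½ ≈⟨ ½+½≈1 ⟩
          1#    ∎
      }
      where
      ≤-½ : ∀ {x} → x ≤ - (∣ σ ∣ + 1#) → x + σ ≤ - ½
      ≤-½ {x} p = ≤-by (+-mono-≤ (+-mono-≤ p (x≤∣x∣ σ)) ½≤1)
        (solve 5 (λ x s t h o → :- (t :+ o) :+ t :+ o :- (x :+ s :+ h) := :- h :- (x :+ s))
          refl x σ ∣ σ ∣ ½ 1#)

      ½≤ : ∀ {x} → ∣ σ ∣ + 1# ≤ x → ½ ≤ x + σ
      ½≤ {x} p = ≤-by (+-mono-≤ (+-mono-≤ p (-x≤∣x∣ σ)) ½≤1)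
        (solve 5 (λ x s t h o → x :+ t :+ o :- (t :+ o :+ :- s :+ h) := x :+ s :- h)
          refl x σ ∣ σ ∣ ½ 1#)

      <-up : ∀ {x y} → x ≤ y → - ½ < x + σ → - ½ < y + σ
      <-up x≤y p = ≰⇒> λ q → <⇒≱ p (≤-trans (+-monoˡ-≤ σ x≤y) q)

      ≤-shift : ∀ {x d} → d ≤ x + σ → d - σ ≤ x
      ≤-shift {x} {d} p = ≤-by p (solve 3 (λ x d s → x :+ s :- d := x :- (d :- s)) refl x d σ)

      ≥-shift : ∀ {x d} → x + σ ≤ d → x ≤ d - σ
      ≥-shift {x} {d} p = ≤-by p (solve 3 (λ x d s → d :- (x :+ s) := d :- s :- x) refl x d σ)

      L? : Decidable (λ x → - ½ < x + σ)
      L? x = NonStrictToStrict.<-decidable _≈_ _≤_ _≟_ _≤?_ (- ½) (x + σ)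

      R? : Decidable (λ x → ½ ≤ x + σ)
      R? x = ½ ≤? x + σ

      module L = Heaviside L? (- ½ - σ) <-up (λ p → ≤-shift (<⇒≤ p))
                   (λ ¬p → ≥-shift (≮⇒≥ ¬p))
      module R = Heaviside R? (½ - σ) (λ x≤y p → ≤-trans p (+-monoˡ-≤ σ x≤y)) ≤-shift
                   (λ ¬p → ≥-shift (<⇒≤ (≰⇒> ¬p)))

      χ-χ≈f₀ : ∀ x → χ ℝ L? x - χ ℝ R? x ≈ f ℝ 0 (x + σ)
      χ-χ≈f₀ x with position (x + σ)
      ... | left p = trans
        (+-cong (reflexive (χ-∉ L? λ q → <⇒≱ q p))
          (-‿cong (reflexive (χ-∉ R? λ q → <⇒≱ -½<½ (≤-trans q p)))))
        (trans (-‿inverseʳ 0#) (sym (f₀-left p)))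
      ... | inside p q = trans
        (+-cong (reflexive (χ-∈ L? p)) (-‿cong (reflexive (χ-∉ R? (<⇒≱ q)))))
        (trans (trans (+-congˡ ε⁻¹≈ε) (+-identityʳ 1#)) (sym (f₀-inside p q)))
      ... | right p = trans
        (+-cong (reflexive (χ-∈ L? (<-≤-trans -½<½ p))) (-‿cong (reflexive (χ-∈ R? p))))
        (trans (-‿inverseʳ 1#) (sym (f₀-right p)))

    -- The integrality condition and the product integral.

    -- d + n/2 ∈ ℤ
    Lattice : ℕ.ℕ → Carrier → Set ℓ₁
    Lattice n d = ∃₂ λ a b → d + n · ½ ≈ fromℕ a - fromℕ b

    lattice-+½ : ∀ n {d e} → e ≈ d + ½ → Lattice (suc n) d → Lattice n e
    lattice-+½ n {d} {e} e≈d+½ (a , b , eq) = a , b , (begin-equality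
      e + n · ½         ≈⟨ +-congʳ e≈d+½ ⟩
      d + ½ + n · ½     ≈⟨ +-assoc d ½ _ ⟩
      d + (½ + n · ½)   ≈⟨ eq ⟩
      fromℕ a - fromℕ b ∎)

    lattice-−½ : ∀ n {d e} → e ≈ d - ½ → Lattice (suc n) d → Lattice n e
    -- Here e + n/2 = d + (n + 1)/2 - 1, so the integer drops by one, which `suc b` records.
    lattice-−½ n {d} {e} e≈d-½ (a , b , eq) = a , suc b , (begin-equality
      e + n · ½                   ≈⟨ +-congʳ e≈d-½ ⟩
      d - ½ + n · ½
        ≈⟨ solve 3 (λ d h w → d :- h :+ w := d :+ (h :+ w) :- (h :+ h)) refl d ½ (n · ½) ⟩
      d + (½ + n · ½) - (½ + ½)   ≈⟨ +-cong eq (-‿cong ½+½≈1) ⟩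
      fromℕ a - fromℕ b - 1#
        ≈⟨ solve 3 (λ a b o → a :- b :- o := a :- (o :+ b)) refl (fromℕ a) (fromℕ b) 1# ⟩
      fromℕ a - fromℕ (suc b)     ∎)

    data IntegerPosition (d : Carrier) : Set (ℓ₁ ⊔ ℓ₂) where
      negative : 1# ≤ - d → IntegerPosition d
      null     : d ≈ 0#   → IntegerPosition d
      positive : 1# ≤ d   → IntegerPosition d

    1≤fromℕ-fromℕ : ∀ {m n} → m ℕ.< n → 1# ≤ fromℕ n - fromℕ m
    1≤fromℕ-fromℕ {m} {n} m<n = ≤-by (fromℕ-mono-≤ m<n)
      (solve 3 (λ o m n → n :- (o :+ m) := n :- m :- o) refl 1# (fromℕ m) (fromℕ n))

    -- Distinct naturals differ by at least 1, so an integer other than 0 has absolute value at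
    -- least 1.
    integerPosition : ∀ {d} → Lattice 0 d → IntegerPosition d
    integerPosition {d} (a , b , eq) with ℕ.<-cmp a b
    ... | tri< a<b _ _ = negative (≤-respʳ-≈
      (trans (sym (⁻¹-anti-homo‿- _ _)) (-‿cong (sym d≈a-b))) (1≤fromℕ-fromℕ a<b))
      where d≈a-b = trans (sym (+-identityʳ d)) eq
    ... | tri≈ _ ≡.refl _ = null (trans (trans (sym (+-identityʳ d)) eq) (-‿inverseʳ _))
    ... | tri> _ _ b<a = positive (≤-respʳ-≈ (trans (sym eq) (+-identityʳ d)) (1≤fromℕ-fromℕ b<a))

    -- Integrality excludes 0 < ∣ σ - τ ∣ < 1, where the intervals overlap in length 1 - ∣ σ - τ ∣,
    -- which is not a value of f₀.
    totalIntegral-f₀f₀ : ∀ σ τ → Lattice 0 (σ - τ) →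
                         TotalIntegral (λ x → f ℝ 0 (x + σ) * f ℝ 0 (x + τ)) (f ℝ 0 (σ - τ))
    totalIntegral-f₀f₀ σ τ L with integerPosition L
    ... | null σ-τ≈0 = totalIntegral-cong
      -- The intervals coincide and f₀ is its own square, so the integral of a single translate is
      -- that of the product.
      (λ x → trans (sym (f₀-idem (x + σ))) (*-congˡ (f-cong 0 (+-congˡ (x∙y⁻¹≈ε⇒x≈y σ τ σ-τ≈0)))))
      (sym (trans (f-cong 0 σ-τ≈0) f₀-0))
      (totalIntegral-f₀ σ)
    ... | positive 1≤σ-τ = totalIntegral-cong
      (λ x → sym (f₀-disjoint (≤-respʳ-≈
        (solve 3 (λ s t x → s :- t := x :+ s :- (x :+ t)) refl σ τ x) 1≤σ-τ)))
      (sym (f₀-right (≤-trans ½≤1 1≤σ-τ)))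
      totalIntegral-0
    ... | negative 1≤τ-σ = totalIntegral-cong
      (λ x → sym (trans (*-comm _ _) (f₀-disjoint (≤-respʳ-≈
        (solve 3 (λ s t x → :- (s :- t) := x :+ t :- (x :+ s)) refl σ τ x) 1≤τ-σ))))
      (sym (f₀-left (≤-by (≤-trans ½≤1 1≤τ-σ)
        (solve 3 (λ s t h → :- (s :- t) :- h := :- h :- (s :- t)) refl σ τ ½))))
      totalIntegral-0

    -- Induction on n, and on m once n is 0. The shifts are general because each unfolding changes
    -- one of them; the half step is paid for by lowering n + m in the integrality condition.
    totalIntegral-ff : ∀ n m σ τ → Lattice (n ℕ.+ m) (σ - τ) →
                       TotalIntegral (λ x → f ℝ n (x + σ) * f ℝ m (x + τ)) (f ℝ (n ℕ.+ m) (σ - τ))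
    totalIntegral-ff zero zero σ τ L = totalIntegral-f₀f₀ σ τ L
    totalIntegral-ff zero (suc m) σ τ L = totalIntegral-cong
      (λ x → trans (sym (distribˡ _ _ _))
        (*-congˡ (+-cong (f-cong m (sym (+-assoc x τ ½))) (f-cong m (sym (+-assoc x τ (- ½)))))))
      -- Raising τ lowers σ - τ, so the two terms arrive in the opposite order.
      (trans (+-comm _ _) (+-cong (f-cong m (sym +½)) (f-cong m (sym −½))))
      (totalIntegral-+
        (totalIntegral-ff zero m σ (τ + ½) (lattice-−½ m (sym −½) L))
        (totalIntegral-ff zero m σ (τ - ½) (lattice-+½ m (sym +½) L)))
      where
      +½ : σ - τ + ½ ≈ σ - (τ - ½)
      +½ = solve 3 (λ s t h → s :- t :+ h := s :- (t :- h)) refl σ τ ½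

      −½ : σ - τ - ½ ≈ σ - (τ + ½)
      −½ = solve 3 (λ s t h → s :- t :- h := s :- (t :+ h)) refl σ τ ½
    totalIntegral-ff (suc n) m σ τ L = totalIntegral-cong
      (λ x → trans (sym (distribʳ _ _ _))
        (*-congʳ (+-cong (f-cong n (sym (+-assoc x σ ½))) (f-cong n (sym (+-assoc x σ (- ½)))))))
      (+-cong (f-cong (n ℕ.+ m) +½) (f-cong (n ℕ.+ m) −½))
      (totalIntegral-+
        (totalIntegral-ff n m (σ + ½) τ (lattice-+½ (n ℕ.+ m) +½ L))
        (totalIntegral-ff n m (σ - ½) τ (lattice-−½ (n ℕ.+ m) −½ L)))
      where
      +½ : σ + ½ - τ ≈ σ - τ + ½
      +½ = solve 3 (λ s t h → s :+ h :- t := s :- t :+ h) refl σ τ ½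

      −½ : σ - ½ - τ ≈ σ - τ - ½
      −½ = solve 3 (λ s t h → s :- h :- t := s :- t :- h) refl σ τ ½

    -- Values of f_n as binomial coefficients.

    -- The support of f_n starts at -(n + 1)/2: each unfolding extends that of f₀ by ½. This
    -- supplies the zeros to the left of Pascal's triangle.
    f-vanishes : ∀ n {x} → x + n · ½ ≤ - ½ → f ℝ n x ≈ 0#
    f-vanishes zero x+0≤-½ = f₀-left (≤-respˡ-≈ (+-identityʳ _) x+0≤-½)
    f-vanishes (suc n) {x} p = trans
      (+-cong (f-vanishes n (≤-respˡ-≈ (sym (+-assoc x ½ _)) p)) (f-vanishes n (≤-trans (≤-by (<⇒≤ -½<½)
        (solve 3 (λ x h w → h :- :- h := x :+ (h :+ w) :- (x :- h :+ w)) refl x ½ (n · ½))) p)))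
      (+-identityʳ 0#)

    -- Moving k - (n + 1)/2 by ½ to either side gives k - n/2 and (k - 1) - n/2, so the recursion of
    -- f is Pascal's rule.
    f-binomial : ∀ n k → f ℝ n (fromℕ k - n · ½) ≈ fromℕ (n ℕ.C k)
    f-binomial zero zero = trans (f-cong 0 (-‿inverseʳ 0#)) (trans f₀-0 (sym (+-identityʳ 1#)))
    f-binomial zero (suc k) = f₀-right (≤-trans ½≤1 (1≤fromℕ-fromℕ {0} {suc k} (s≤s z≤n)))
    f-binomial (suc n) zero = begin-equality
      f ℝ n (0# - (½ + n · ½) + ½) + f ℝ n (0# - (½ + n · ½) - ½)
        ≈⟨ +-cong (f-cong n (solve 3 (λ z h w → z :- (h :+ w) :+ h := z :- w) refl 0# ½ (n · ½)))
                  -- The left neighbour -1 - n/2 is outside the support, in the role of C(n , -1) =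
                  -- 0.
                  (f-vanishes n (≤-by (<⇒≤ 0<½)
                    (solve 3 (λ z h w → h :- z := :- h :- (z :- (h :+ w) :- h :+ w)) refl 0# ½ (n · ½)))) ⟩
      f ℝ n (0# - n · ½) + 0#   ≈⟨ +-identityʳ _ ⟩
      f ℝ n (0# - n · ½)        ≈⟨ f-binomial n zero ⟩
      fromℕ (n ℕ.C 0)           ≡⟨ ≡.cong fromℕ (≡.trans (nC0≡1 n) (≡.sym (nC0≡1 (suc n)))) ⟩
      fromℕ (suc n ℕ.C 0)       ∎
    f-binomial (suc n) (suc k) = begin-equality
      f ℝ n (1# + fromℕ k - (½ + n · ½) + ½) + f ℝ n (1# + fromℕ k - (½ + n · ½) - ½)
        ≈⟨ +-cong
             (f-cong n (solve 3 (λ k h w → k :- (h :+ w) :+ h := k :- w) refl (1# + fromℕ k) ½ (n · ½)))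
             (f-cong n (1+x-[½+y]-½ (fromℕ k) (n · ½))) ⟩
      f ℝ n (fromℕ (suc k) - n · ½) + f ℝ n (fromℕ k - n · ½)
        ≈⟨ +-cong (f-binomial n (suc k)) (f-binomial n k) ⟩
      fromℕ (n ℕ.C suc k) + fromℕ (n ℕ.C k)  ≈⟨ +-comm _ _ ⟩
      fromℕ (n ℕ.C k) + fromℕ (n ℕ.C suc k)  ≈⟨ ×-homo-+ 1# (n ℕ.C k) _ ⟨
      fromℕ (n ℕ.C k ℕ.+ n ℕ.C suc k)        ≡⟨ ≡.cong fromℕ (ℕ.nCk+nC[k+1]≡[n+1]C[k+1] n k) ⟩
      fromℕ (suc n ℕ.C suc k)                ∎
      where
      1+x-[½+y]-½ : ∀ x y → 1# + x - (½ + y) - ½ ≈ x - y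
      1+x-[½+y]-½ x y = begin-equality
        1# + x - (½ + y) - ½      ≈⟨ +-congʳ (+-congʳ (+-congʳ ½+½≈1)) ⟨
        ½ + ½ + x - (½ + y) - ½   ≈⟨ solve 3 (λ x y h → h :+ h :+ x :- (h :+ y) :- h := x :- y) refl x y ½ ⟩
        x - y                     ∎

    [n+n]·½≈n : ∀ n → (n ℕ.+ n) · ½ ≈ fromℕ n
    [n+n]·½≈n n = begin-equality
      (n ℕ.+ n) · ½   ≈⟨ ×-homo-+ ½ n n ⟩
      n · ½ + n · ½   ≈⟨ ×-distrib-+ ½ ½ n ⟨
      n · (½ + ½)     ≈⟨ ×-congʳ n ½+½≈1 ⟩
      fromℕ n         ∎

  -- Take σ = τ = 0. Since (n + m)/2 = k, the integrality witness is k - 0, and 0 is the point k -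
  -- (n + m)/2 at which f_(n+m) has the binomial value.
  improperIntegral-ff : ∀ n m k → n ℕ.+ m ≡ k ℕ.+ k →
    HasImproperIntegral ℝ (λ x → f ℝ n x * f ℝ m x) (fromℕ ((n ℕ.+ m) ℕ.C k))
  improperIntegral-ff n m k n+m≡k+k = hasImproperIntegral (totalIntegral-cong
    (λ x → *-cong (f-cong n (+-identityʳ x)) (f-cong m (+-identityʳ x)))
    (trans (f-cong (n ℕ.+ m) 0-0≈k-[n+m]·½) (f-binomial (n ℕ.+ m) k))
    (totalIntegral-ff n m 0# 0# (k , 0 , lattice)))
    where
    [n+m]·½≈k : (n ℕ.+ m) · ½ ≈ fromℕ k
    [n+m]·½≈k = trans (reflexive (≡.cong (_· ½) n+m≡k+k)) ([n+n]·½≈n k)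

    0-0≈k-[n+m]·½ : 0# - 0# ≈ fromℕ k - (n ℕ.+ m) · ½
    0-0≈k-[n+m]·½ = trans (-‿inverseʳ 0#) (sym (x≈y⇒x∙y⁻¹≈ε (sym [n+m]·½≈k)))

    lattice : 0# - 0# + (n ℕ.+ m) · ½ ≈ fromℕ k - 0#
    lattice = begin-equality
      0# - 0# + (n ℕ.+ m) · ½  ≈⟨ +-cong (-‿inverseʳ 0#) [n+m]·½≈k ⟩
      0# + fromℕ k             ≈⟨ +-comm _ _ ⟩
      fromℕ k + 0#             ≈⟨ +-congˡ ε⁻¹≈ε ⟨
      fromℕ k - 0#             ∎

-- Parity of n + m and the theorem.

open import Data.Nat.Base using (ℕ; _≤_; _+_; _/_; _%_)
open import Data.Nat.Combinatorics using (_C_)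

-- Modulo 2 the sum n + m agrees with m + m, so division by 2 leaves no remainder.
≡-mod-2⇒double : ∀ n m → n % 2 ≡ m % 2 → n + m ≡ (n + m) / 2 + (n + m) / 2
≡-mod-2⇒double n m n≡m = begin
  n + m                                    ≡⟨ ℕ.m≡m%n+[m/n]*n (n + m) 2 ⟩
  (n + m) % 2 + (n + m) / 2 ℕ.* 2          ≡⟨ ≡.cong (_+ (n + m) / 2 ℕ.* 2) even ⟩
  (n + m) / 2 ℕ.* 2                        ≡⟨ ℕ.*-comm ((n + m) / 2) 2 ⟩
  (n + m) / 2 + ((n + m) / 2 + 0)          ≡⟨ ≡.cong ((n + m) / 2 +_) (ℕ.+-identityʳ _) ⟩
  (n + m) / 2 + (n + m) / 2                ∎
  where
  open ≡.≡-Reasoning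

  even : (n + m) % 2 ≡ 0
  even = begin
    (n + m) % 2              ≡⟨ ℕ.%-distribˡ-+ n m 2 ⟩
    (n % 2 + m % 2) % 2      ≡⟨ ≡.cong (λ r → (r + m % 2) % 2) n≡m ⟩
    (m % 2 + m % 2) % 2      ≡⟨ ℕ.%-distribˡ-+ m m 2 ⟨
    (m + m) % 2              ≡⟨ ≡.cong (λ r → (m + r) % 2) (ℕ.+-identityʳ m) ⟨
    (2 ℕ.* m) % 2            ≡⟨ ≡.cong (_% 2) (ℕ.*-comm 2 m) ⟩
    (m ℕ.* 2) % 2            ≡⟨ ℕ.m*n%n≡0 m 2 ⟩
    0                        ∎

mainTheorem5 : ∀ {c ℓ₁ ℓ₂} (ℝ : CompleteOrderedField c ℓ₁ ℓ₂) (n m : ℕ) → m ≤ n → n % 2 ≡ m % 2 →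
    HasImproperIntegral ℝ (λ x → CompleteOrderedField._*_ ℝ (f ℝ n x) (f ℝ m x))
    (CompleteOrderedField.fromℕ ℝ ((n + m) C ((n + m) / 2)))
mainTheorem5 ℝ n m _ n≡m = improperIntegral-ff ℝ n m ((n + m) / 2) (≡-mod-2⇒double n m n≡m)
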